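{- Let $\mathcal{C}$ be a hereditary class of cographs. Then $\mathcal{C}$ has bounded linear clique-width if and only if $\mathcal{C}$ contains neither all quasi-threshold graphs nor the complements of all quasi-threshold graphs. That is: there is a constant $c$ with $\operatorname{lcw}(G)\le c$ for all $G\in\mathcal{C}$ if and only if some quasi-threshold graph is not in $\mathcal{C}$ and the complement of some quasi-threshold graph is not in $\mathcal{C}$.
   Context: All graphs are finite and simple and have at least one vertex. A hereditary class is a set of graphs closed under isomorphism and under taking induced subgraphs. The join $G\ast H$ of vertex-disjoint graphs $G,H$ is obtained from the disjoint union $G\cup H$ by adding all edges between $G$ and $H$. A cograph is a graph that can be built, starting with $K_1$, by repeatedly taking the disjoint union or join of two cographs (equivalently, a graph with no induced $P_4$). A quasi-threshold graph is a graph that can be built, starting with $K_1$, by repeatedly taking the disjoint union of two quasi-threshold graphs, or the join of a quasi-threshold graph with $K_1$ (equivalently, a graph with no induced $P_4$ or $C_4$). The linear clique-width $\operatorname{lcw}(G)$ of a graph $G$ is the size of the smallest alphabet $\Sigma$ such that $G$ can be constructed (starting from nothing) by a sequence of the following operations: (1) add a new vertex labeled by a letter in $\Sigma$; (2) for letters $i\ne j$, add edges between all vertices currently labeled $i$ and all vertices currently labeled $j$; (3) give all vertices currently labeled $i$ the label $j$. A class has bounded linear clique-width if $\operatorname{lcw}$ is bounded by a constant on its members. -}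

module Defs where

open import Data.Bool using (Bool; true; false; not; _∧_; _∨_)
open import Data.Bool.Properties using (∧-comm; ∨-comm)
open import Data.Fin using (Fin; zero; suc; _≟_; splitAt)
open import Data.Nat using (ℕ; zero; suc; _+_; _≤_)
open import Data.Nat.Properties using (≤-trans)
open import Data.Product using (∃-syntax; _×_; _,_)
open import Data.Sum using (_⊎_; inj₁; inj₂)
open import Function.Bundles using (_↔_; _↣_; _⇔_; mk⇔; Inverse; Injection)
open import Level using (Level)
open import Relation.Binary.PropositionalEquality
  using (_≡_; _≢_; refl; sym; trans; cong; cong₂)
open import Relation.Nullary using (yes; no; contradiction)
open import Relation.Nullary.Decidable using (⌊_⌋)
open import Relation.Unary using (Pred)

-- The vertex set is Fin (suc pred-order), so a graph has at least one vertex.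
record Graph : Set where
  field
    pred-order : ℕ

  order : ℕ
  order = suc pred-order

  Vertex : Set
  Vertex = Fin order

  field
    adj        : Vertex → Vertex → Bool
    adj-sym    : ∀ u v → adj u v ≡ adj v u
    adj-irrefl : ∀ v → adj v v ≡ false

open Graph public

infix 4 _≅_ _⊑_

record _≅_ (G H : Graph) : Set where
  field
    bijection : Vertex G ↔ Vertex H
    preserves : ∀ u v → adj G u v ≡ adj H (Inverse.to bijection u) (Inverse.to bijection v)

-- H ⊑ G: H is isomorphic to the subgraph of G induced on the image of the injection.
record _⊑_ (H G : Graph) : Set where
  field
    injection : Vertex H ↣ Vertex G
    preserves : ∀ u v → adj H u v ≡ adj G (Injection.to injection u) (Injection.to injection v)

record Hereditary {ℓ : Level} (C : Pred Graph ℓ) : Set ℓ where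
  field
    ≅-closed : ∀ {G H} → G ≅ H → C G → C H
    ⊑-closed : ∀ {G H} → H ⊑ G → C G → C H

K₁ : Graph
K₁ = record
  { pred-order = 0
  ; adj        = λ _ _ → false
  ; adj-sym    = λ _ _ → refl
  ; adj-irrefl = λ _ → refl
  }

complement : Graph → Graph
complement G = record
  { pred-order = pred-order G
  ; adj        = λ u v → not ⌊ u ≟ v ⌋ ∧ not (adj G u v)
  ; adj-sym    = λ u v → cong₂ _∧_ (cong not (≟-sym u v)) (cong not (adj-sym G u v))
  ; adj-irrefl = irr
  }
  where
  ≟-sym : ∀ (u v : Vertex G) → ⌊ u ≟ v ⌋ ≡ ⌊ v ≟ u ⌋
  ≟-sym u v with u ≟ v | v ≟ u
  ... | yes _ | yes _ = refl
  ... | no  _ | no  _ = refl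
  ... | yes p | no  q = contradiction (sym p) q
  ... | no  p | yes q = contradiction (sym q) p

  irr : ∀ v → not ⌊ v ≟ v ⌋ ∧ not (adj G v v) ≡ false
  irr v with v ≟ v
  ... | yes _ = refl
  ... | no  p = contradiction refl p

-- The graph on the disjoint union of the vertex sets in which every pair
-- (vertex of G, vertex of H) has adjacency b.  splitAt sends the first
-- `order G` vertices to G and the remaining ones to H.
module Glue (b : Bool) (G H : Graph) where

  adj⊎ : Vertex G ⊎ Vertex H → Vertex G ⊎ Vertex H → Bool
  adj⊎ (inj₁ u) (inj₁ v) = adj G u v
  adj⊎ (inj₂ u) (inj₂ v) = adj H u v
  adj⊎ (inj₁ _) (inj₂ _) = b
  adj⊎ (inj₂ _) (inj₁ _) = b

  adj⊎-sym : ∀ x y → adj⊎ x y ≡ adj⊎ y x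
  adj⊎-sym (inj₁ u) (inj₁ v) = adj-sym G u v
  adj⊎-sym (inj₂ u) (inj₂ v) = adj-sym H u v
  adj⊎-sym (inj₁ _) (inj₂ _) = refl
  adj⊎-sym (inj₂ _) (inj₁ _) = refl

  adj⊎-irrefl : ∀ x → adj⊎ x x ≡ false
  adj⊎-irrefl (inj₁ v) = adj-irrefl G v
  adj⊎-irrefl (inj₂ v) = adj-irrefl H v

  split : Fin (order G + order H) → Vertex G ⊎ Vertex H
  split = splitAt (order G)

  graph : Graph
  graph = record
    { pred-order = pred-order G + order H
    ; adj        = λ u v → adj⊎ (split u) (split v)
    ; adj-sym    = λ u v → adj⊎-sym (split u) (split v)
    ; adj-irrefl = λ v → adj⊎-irrefl (split v)
    }

infixr 6 _∪_ _∗_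

_∪_ : Graph → Graph → Graph
_∪_ = Glue.graph false

_∗_ : Graph → Graph → Graph
_∗_ = Glue.graph true

data Cograph : Graph → Set where
  single : Cograph K₁
  union  : ∀ {G H} → Cograph G → Cograph H → Cograph (G ∪ H)
  join   : ∀ {G H} → Cograph G → Cograph H → Cograph (G ∗ H)
  iso    : ∀ {G H} → G ≅ H → Cograph G → Cograph H

data QuasiThreshold : Graph → Set where
  single : QuasiThreshold K₁
  union  : ∀ {G H} → QuasiThreshold G → QuasiThreshold H → QuasiThreshold (G ∪ H)
  join   : ∀ {G} → QuasiThreshold G → QuasiThreshold (G ∗ K₁)
  iso    : ∀ {G H} → G ≅ H → QuasiThreshold G → QuasiThreshold H

-- Sequences of operations over the alphabet Fin k that create n vertices.
data Construction (k : ℕ) : ℕ → Set where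
  start     : Construction k 0
  addVertex : ∀ {n} → Fin k → Construction k n → Construction k (suc n)
  connect   : ∀ {n} (i j : Fin k) → i ≢ j → Construction k n → Construction k n
  relabel   : ∀ {n} (i j : Fin k) → Construction k n → Construction k n

-- `relabel i j` gives all vertices currently labelled i the label j.
rename : ∀ {k} → Fin k → Fin k → Fin k → Fin k
rename i j l with l ≟ i
... | yes _ = j
... | no  _ = l

-- The most recently added vertex is `zero`.
label : ∀ {k n} → Construction k n → Fin n → Fin k
label (addVertex i e)   zero    = i
label (addVertex i e)   (suc v) = label e v
label (connect i j _ e) v       = label e v
label (relabel i j e)   v       = rename i j (label e v)

edge : ∀ {k n} → Construction k n → Fin n → Fin n → Bool
edge (addVertex _ e)   zero    _       = false
edge (addVertex _ e)   (suc _) zero    = false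
edge (addVertex _ e)   (suc u) (suc v) = edge e u v
edge (connect i j _ e) u       v       =
  edge e u v ∨ ((⌊ label e u ≟ i ⌋ ∧ ⌊ label e v ≟ j ⌋)
             ∨  (⌊ label e u ≟ j ⌋ ∧ ⌊ label e v ≟ i ⌋))
edge (relabel _ _ e)   u       v       = edge e u v

edge-sym : ∀ {k n} (e : Construction k n) u v → edge e u v ≡ edge e v u
edge-sym (addVertex _ e)   zero    zero    = refl
edge-sym (addVertex _ e)   zero    (suc _) = refl
edge-sym (addVertex _ e)   (suc _) zero    = refl
edge-sym (addVertex _ e)   (suc u) (suc v) = edge-sym e u v
edge-sym (connect i j _ e) u       v       =
  cong₂ _∨_ (edge-sym e u v)
    (trans (∨-comm (ui ∧ vj) (uj ∧ vi)) (cong₂ _∨_ (∧-comm uj vi) (∧-comm ui vj)))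
  where
  ui = ⌊ label e u ≟ i ⌋
  uj = ⌊ label e u ≟ j ⌋
  vi = ⌊ label e v ≟ i ⌋
  vj = ⌊ label e v ≟ j ⌋
edge-sym (relabel _ _ e)   u       v       = edge-sym e u v

edge-irrefl : ∀ {k n} (e : Construction k n) v → edge e v v ≡ false
edge-irrefl (addVertex _ e)     zero    = refl
edge-irrefl (addVertex _ e)     (suc v) = edge-irrefl e v
edge-irrefl (connect i j i≢j e) v
  rewrite edge-irrefl e v with label e v ≟ i | label e v ≟ j
... | yes p | yes q = contradiction (trans (sym p) q) i≢j
... | yes _ | no  _ = refl
... | no  _ | yes _ = refl
... | no  _ | no  _ = refl
edge-irrefl (relabel _ _ e)     v       = edge-irrefl e v

constructed : ∀ {k m} → Construction k (suc m) → Graph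
constructed {m = m} e = record
  { pred-order = m
  ; adj        = edge e
  ; adj-sym    = edge-sym e
  ; adj-irrefl = edge-irrefl e
  }

ConstructibleWith : ℕ → Graph → Set
ConstructibleWith k G = ∃[ m ] ∃[ e ] constructed {k} {m} e ≅ G

IsLcw : Graph → ℕ → Set
IsLcw G k = ConstructibleWith k G × (∀ j → ConstructibleWith j G → k ≤ j)

-- lcw is a minimum, so lcw(G) ≤ c says that some alphabet of size at most c
-- suffices.  This form does not presuppose a procedure computing the minimum;
-- lcw≤-⇔ confirms that it is the comparison of the number lcw(G) with c.
lcw[_]≤_ : Graph → ℕ → Set
lcw[ G ]≤ c = ∃[ k ] k ≤ c × ConstructibleWith k G

lcw≤-⇔ : ∀ {G k} → IsLcw G k → ∀ c → (lcw[ G ]≤ c) ⇔ k ≤ c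
lcw≤-⇔ {k = k} (con , least) c = mk⇔
  (λ (j , j≤c , con′) → ≤-trans (least j con′) j≤c)
  (λ k≤c → k , k≤c , con)

BoundedLcw : ∀ {ℓ} → Pred Graph ℓ → Set ℓ
BoundedLcw C = ∃[ c ] ∀ G → C G → lcw[ G ]≤ c

{-# OPTIONS --safe #-}
module Submission where

-- Upper bound.  Let T 0 = K₁ and T (suc n) = (T n ∪ T n) ∗ K₁; every quasi-threshold graph embeds
-- in some T n.  Let G be a cograph containing neither T (suc m) nor the complement of T (suc n).
-- If G contains neither T m ∪ T m nor the complement of T n ∪ T n, then at each union node of its
-- cotree one branch avoids T m, and at each join node one branch avoids the complement of T n; by
-- induction these branches have bounded width and can be attached one at a time along the path
-- formed by the others, at the cost of one label.  In general G is an iterated union, or an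
-- iterated join, of cographs of this kind, which costs one more label.
--
-- Lower bound.  Vertices sharing a label have the same neighbours among the vertices added later,
-- so an alphabet of size k allows at most k distinct rows of the adjacency matrix across any cut of
-- the insertion order.  Each step U (suc n) = (U n ∪ U n ∪ U n) ∗ K₁ forces one more distinct row:
-- of the three cuts provided by the copies of U n, use the median one.  Complementing a graph
-- preserves distinctness of rows.

open import Defs
open import Data.Bool using (Bool; true; false; not; _∧_; _∨_)
open import Data.Bool.Properties
  using (∨-identityʳ; ∧-zeroʳ; ¬-not; not-involutive; not-injective)
  renaming (_≟_ to _≟ᵇ_)
open import Data.Empty using (⊥)
open import Data.Fin using (Fin; zero; suc; toℕ; _≟_) renaming (join to joinᶠ; _<_ to _<ᶠ_)
open import Data.Fin.Properties using (+↔⊎; pigeonhole; toℕ-injective)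
open import Data.List using (List; []; _∷_; allFin)
open import Data.List.Membership.Propositional using (_∈_; _∉_)
open import Data.List.Membership.Propositional.Properties using (∈-allFin)
open import Data.List.Relation.Unary.Any using (here; there)
open import Data.Nat using (ℕ; zero; suc; _+_; _⊔_; _≤_; _<_; s≤s; s<s)
open import Data.Nat.Properties
  using (≤-trans; ≤-refl; ≤-total; ≤-<-connex; <-cmp; <-≤-trans; <⇒≱;
         m≤m⊔n; m≤n⊔m; +-suc; suc-injective)
open import Data.Product using (Σ; ∃-syntax; _×_; _,_; proj₁; proj₂; map)
open import Data.Sum using (_⊎_; inj₁; inj₂; [_,_]′) renaming (map to ⊎-map)
open import Data.Sum.Algebra using (⊎-comm)
open import Data.Sum.Function.Propositional using (_⊎-↔_)
open import Data.Sum.Properties using (inj₁-injective; inj₂-injective)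
open import Data.Unit using (⊤; tt)
open import Function using (_∘_; id; const)
open import Function.Bundles using (_⇔_; _↔_; mk⇔; mk↣; mk↔ₛ′; Inverse; Injection)
open import Function.Properties.Inverse using (↔-refl; ↔-sym; ↔-trans; ↔⇒↣)
open import Level using (Level)
open import Relation.Binary.Definitions using (tri<; tri≈; tri>)
open import Relation.Binary.PropositionalEquality
  using (_≡_; _≢_; refl; sym; trans; cong; cong₂; subst)
open import Relation.Nullary using (¬_; Dec; yes; no; contradiction)
open import Relation.Nullary.Decidable using (⌊_⌋; isYes≗does; _×-dec_; _⊎-dec_)
open import Relation.Unary using (Pred; _⊆_)

open Inverse using (to; from; strictlyInverseˡ; strictlyInverseʳ)

-- Adjacency relations on arbitrary vertex types

Adjacency : Set → Set
Adjacency V = V → V → Bool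

-- With a sum type as vertex set instead of `Fin (m + n)`, congruence, commutativity and
-- associativity become case analyses.
glue : ∀ {A B} → Bool → Adjacency A → Adjacency B → Adjacency (A ⊎ B)
glue b R S (inj₁ x) (inj₁ y) = R x y
glue b R S (inj₁ x) (inj₂ y) = b
glue b R S (inj₂ x) (inj₁ y) = b
glue b R S (inj₂ x) (inj₂ y) = S x y

infix 4 _≃_

record _≃_ {A B : Set} (R : Adjacency A) (S : Adjacency B) : Set where
  constructor mk≃
  field
    bij : A ↔ B
    pres : ∀ x y → R x y ≡ S (to bij x) (to bij y)

open _≃_

≃-refl : ∀ {A} {R : Adjacency A} → R ≃ R
≃-refl = mk≃ ↔-refl λ _ _ → refl

≃-trans : ∀ {A B C} {R : Adjacency A} {S : Adjacency B} {T : Adjacency C} →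
  R ≃ S → S ≃ T → R ≃ T
≃-trans f g = mk≃ (↔-trans (bij f) (bij g)) λ x y → trans (pres f x y) (pres g _ _)

≃-sym : ∀ {A B} {R : Adjacency A} {S : Adjacency B} → R ≃ S → S ≃ R
≃-sym {S = S} f = mk≃ (↔-sym (bij f)) λ x y →
  sym (trans (pres f _ _)
    (cong₂ S (strictlyInverseˡ (bij f) x) (strictlyInverseˡ (bij f) y)))

glue-cong : ∀ {A B A′ B′ b} {R : Adjacency A} {S : Adjacency B}
  {R′ : Adjacency A′} {S′ : Adjacency B′} →
  R ≃ R′ → S ≃ S′ → glue b R S ≃ glue b R′ S′
glue-cong {b = b} {R} {S} {R′} {S′} f g = mk≃ (bij f ⊎-↔ bij g) p
  where
  p : ∀ x y → glue b R S x y
    ≡ glue b R′ S′ (to (bij f ⊎-↔ bij g) x) (to (bij f ⊎-↔ bij g) y)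
  p (inj₁ x) (inj₁ y) = pres f x y
  p (inj₁ _) (inj₂ _) = refl
  p (inj₂ _) (inj₁ _) = refl
  p (inj₂ x) (inj₂ y) = pres g x y

glue-comm : ∀ {A B b} {R : Adjacency A} {S : Adjacency B} → glue b R S ≃ glue b S R
glue-comm {A} {B} {b} {R} {S} = mk≃ (⊎-comm A B) p
  where
  p : ∀ x y → glue b R S x y ≡ glue b S R (to (⊎-comm A B) x) (to (⊎-comm A B) y)
  p (inj₁ _) (inj₁ _) = refl
  p (inj₁ _) (inj₂ _) = refl
  p (inj₂ _) (inj₁ _) = refl
  p (inj₂ _) (inj₂ _) = refl

glue-assoc : ∀ {A B C b} {R : Adjacency A} {S : Adjacency B} {T : Adjacency C} →
  glue b (glue b R S) T ≃ glue b R (glue b S T)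
glue-assoc {b = b} {R} {S} {T} = mk≃ (mk↔ₛ′ f g fg gf) p
  where
  f : _
  f (inj₁ (inj₁ x)) = inj₁ x
  f (inj₁ (inj₂ x)) = inj₂ (inj₁ x)
  f (inj₂ x)        = inj₂ (inj₂ x)
  g : _
  g (inj₁ x)        = inj₁ (inj₁ x)
  g (inj₂ (inj₁ x)) = inj₁ (inj₂ x)
  g (inj₂ (inj₂ x)) = inj₂ x
  fg : ∀ x → f (g x) ≡ x
  fg (inj₁ x)        = refl
  fg (inj₂ (inj₁ x)) = refl
  fg (inj₂ (inj₂ x)) = refl
  gf : ∀ x → g (f x) ≡ x
  gf (inj₁ (inj₁ x)) = refl
  gf (inj₁ (inj₂ x)) = refl
  gf (inj₂ x)        = refl
  p : ∀ x y → glue b (glue b R S) T x y ≡ glue b R (glue b S T) (f x) (f y)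
  p (inj₁ (inj₁ _)) (inj₁ (inj₁ _)) = refl
  p (inj₁ (inj₁ _)) (inj₁ (inj₂ _)) = refl
  p (inj₁ (inj₁ _)) (inj₂ _)        = refl
  p (inj₁ (inj₂ _)) (inj₁ (inj₁ _)) = refl
  p (inj₁ (inj₂ _)) (inj₁ (inj₂ _)) = refl
  p (inj₁ (inj₂ _)) (inj₂ _)        = refl
  p (inj₂ _)        (inj₁ (inj₁ _)) = refl
  p (inj₂ _)        (inj₁ (inj₂ _)) = refl
  p (inj₂ _)        (inj₂ _)        = refl

≅⇒≃ : ∀ {G H} → G ≅ H → adj G ≃ adj H
≅⇒≃ i = mk≃ (_≅_.bijection i) (_≅_.preserves i)

≃⇒≅ : ∀ {G H} → adj G ≃ adj H → G ≅ H
≃⇒≅ i = record { bijection = bij i ; preserves = pres i }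

-- Cotrees

-- Label `true` stands for join and `false` for union. Labels need not alternate along a branch.
data Cotree : Set where
  leaf : Cotree
  node : (b : Bool) (l r : Cotree) → Cotree

Leaf : Cotree → Set
Leaf leaf         = ⊤
Leaf (node _ l r) = Leaf l ⊎ Leaf r

adjᵗ : ∀ t → Adjacency (Leaf t)
adjᵗ leaf         _ _ = false
adjᵗ (node b l r)     = glue b (adjᵗ l) (adjᵗ r)

some-leaf : ∀ t → Leaf t
some-leaf leaf         = tt
some-leaf (node _ l _) = inj₁ (some-leaf l)

adjᵗ-irrefl : ∀ t x → adjᵗ t x x ≡ false
adjᵗ-irrefl leaf         x        = refl
adjᵗ-irrefl (node _ l _) (inj₁ x) = adjᵗ-irrefl l x
adjᵗ-irrefl (node _ _ r) (inj₂ x) = adjᵗ-irrefl r x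

Glue-≃ : ∀ b G H → glue b (adj G) (adj H) ≃ adj (Glue.graph b G H)
Glue-≃ b G H = mk≃ (↔-sym +↔⊎) p
  where
  open Glue b G H using (adj⊎; split)
  q : ∀ x y → glue b (adj G) (adj H) x y ≡ adj⊎ x y
  q (inj₁ _) (inj₁ _) = refl
  q (inj₁ _) (inj₂ _) = refl
  q (inj₂ _) (inj₁ _) = refl
  q (inj₂ _) (inj₂ _) = refl
  p : ∀ x y → glue b (adj G) (adj H) x y
    ≡ adj⊎ (split (from +↔⊎ x)) (split (from +↔⊎ y))
  p x y = trans (q x y) (sym (cong₂ adj⊎ (strictlyInverseˡ +↔⊎ x) (strictlyInverseˡ +↔⊎ y)))

leaf-≃ : adjᵗ leaf ≃ adj K₁
leaf-≃ = mk≃ (mk↔ₛ′ (λ _ → zero) (λ _ → tt) (λ { zero → refl }) λ _ → refl) λ _ _ → refl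

node-≃ : ∀ {b l r G H} → adjᵗ l ≃ adj G → adjᵗ r ≃ adj H →
  adjᵗ (node b l r) ≃ adj (Glue.graph b G H)
node-≃ {b} {G = G} {H} f g = ≃-trans (glue-cong f g) (Glue-≃ b G H)

cotree : ∀ {G} → Cograph G → ∃[ t ] (adjᵗ t ≃ adj G)
cotree single      = leaf , leaf-≃
cotree (union c d) = _ , node-≃ (proj₂ (cotree c)) (proj₂ (cotree d))
cotree (join c d)  = _ , node-≃ (proj₂ (cotree c)) (proj₂ (cotree d))
cotree (iso i c)   = _ , ≃-trans (proj₂ (cotree c)) (≅⇒≃ i)

-- Building a cograph linearly

mergeInto₀ : ∀ {k n} → List (Fin (suc k)) → Construction (suc k) n → Construction (suc k) n
mergeInto₀ []       e = e
mergeInto₀ (i ∷ is) e = relabel i zero (mergeInto₀ is e)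

-- Every relabelling goes to 0, so a vertex that reaches 0 stays there; one that never moves has a
-- label outside `is`.
mergeInto₀-label : ∀ {k n} is (e : Construction (suc k) n) v →
  label (mergeInto₀ is e) v ≡ zero
    ⊎ (label (mergeInto₀ is e) v ≡ label e v × label e v ∉ is)
mergeInto₀-label []       e v = inj₂ (refl , λ ())
mergeInto₀-label (i ∷ is) e v with mergeInto₀-label is e v | label (mergeInto₀ is e) v ≟ i
... | _               | yes _ = inj₁ refl
... | inj₁ p          | no _  = inj₁ p
... | inj₂ (p , l∉is) | no ≢i = inj₂ (p , λ { (here q) → ≢i (trans p q) ; (there q) → l∉is q })

mergeInto₀-edge : ∀ {k n} is (e : Construction (suc k) n) u v →
  edge (mergeInto₀ is e) u v ≡ edge e u v
mergeInto₀-edge []       e u v = refl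
mergeInto₀-edge (i ∷ is) e u v = mergeInto₀-edge is e u v

mergeAll : ∀ {k n} → Construction (suc k) n → Construction (suc k) n
mergeAll = mergeInto₀ (allFin _)

mergeAll-label : ∀ {k n} (e : Construction (suc k) n) v → label (mergeAll e) v ≡ zero
mergeAll-label e v with mergeInto₀-label (allFin _) e v
... | inj₁ p       = p
... | inj₂ (_ , q) = contradiction (∈-allFin _) q

-- The operations of `e` follow those of `f` with labels shifted by one. They never name label 0, so
-- an `f` whose vertices all carry 0 is left untouched.
append : ∀ {k m n} → Construction k m → Construction (suc k) n → Construction (suc k) (m + n)
append start             f = f
append (addVertex i e)   f = addVertex (suc i) (append e f)
append (connect i j p e) f = connect (suc i) (suc j) (λ { refl → p refl }) (append e f)
append (relabel i j e)   f = relabel (suc i) (suc j) (append e f)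

suc-≟ : ∀ {k} (i j : Fin k) → ⌊ suc i ≟ suc j ⌋ ≡ ⌊ i ≟ j ⌋
suc-≟ i j = trans (isYes≗does (suc i ≟ suc j)) (sym (isYes≗does (i ≟ j)))

module _ {k n : ℕ} (f : Construction (suc k) n) (f₀ : ∀ v → label f v ≡ zero) where

  label⊎ : ∀ {m} → Construction k m → Fin m ⊎ Fin n → Fin (suc k)
  label⊎ e = [ suc ∘ label e , const zero ]′

  append-label : ∀ {m} (e : Construction k m) x →
    label (append e f) (joinᶠ m n x) ≡ label⊎ e x
  append-label start             (inj₂ v)       = f₀ v
  append-label (addVertex i e)   (inj₁ zero)    = refl
  append-label (addVertex i e)   (inj₁ (suc u)) = append-label e (inj₁ u)
  append-label (addVertex i e)   (inj₂ v)       = append-label e (inj₂ v)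
  append-label (connect _ _ _ e) x              = append-label e x
  append-label (relabel i j e)   (inj₁ u)
    rewrite append-label e (inj₁ u) with label e u ≟ i
  ... | yes _ = refl
  ... | no _  = refl
  append-label (relabel i j e)   (inj₂ v)
    rewrite append-label e (inj₂ v) = refl

  append-edge : ∀ {m} (e : Construction k m) x y →
    edge (append e f) (joinᶠ m n x) (joinᶠ m n y) ≡ glue false (edge e) (edge f) x y
  append-edge start             (inj₂ _)       (inj₂ _)       = refl
  append-edge (addVertex _ e)   (inj₁ zero)    (inj₁ _)       = refl
  append-edge (addVertex _ e)   (inj₁ zero)    (inj₂ _)       = refl
  append-edge (addVertex _ e)   (inj₁ (suc _)) (inj₁ zero)    = refl
  append-edge (addVertex _ e)   (inj₁ (suc x)) (inj₁ (suc y)) = append-edge e (inj₁ x) (inj₁ y)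
  append-edge (addVertex _ e)   (inj₁ (suc x)) (inj₂ y)       = append-edge e (inj₁ x) (inj₂ y)
  append-edge (addVertex _ e)   (inj₂ _)       (inj₁ zero)    = refl
  append-edge (addVertex _ e)   (inj₂ x)       (inj₁ (suc y)) = append-edge e (inj₂ x) (inj₁ y)
  append-edge (addVertex _ e)   (inj₂ x)       (inj₂ y)       = append-edge e (inj₂ x) (inj₂ y)
  append-edge (relabel _ _ e)   x              y              = append-edge e x y
  append-edge (connect i j i≢j e) x            y
    rewrite append-edge e x y | append-label e x | append-label e y = new x y
    where
    old = glue false (edge e) (edge f)
    new : ∀ x y →
      old x y ∨ ((⌊ label⊎ e x ≟ suc i ⌋ ∧ ⌊ label⊎ e y ≟ suc j ⌋)
              ∨  (⌊ label⊎ e x ≟ suc j ⌋ ∧ ⌊ label⊎ e y ≟ suc i ⌋))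
      ≡ glue false (edge (connect i j i≢j e)) (edge f) x y
    new (inj₁ u) (inj₁ v)
      rewrite suc-≟ (label e u) i | suc-≟ (label e v) j
            | suc-≟ (label e u) j | suc-≟ (label e v) i = refl
    new (inj₁ u) (inj₂ v)
      rewrite ∧-zeroʳ ⌊ label⊎ e (inj₁ u) ≟ suc i ⌋ = ∧-zeroʳ _
    new (inj₂ _) (inj₁ _) = refl
    new (inj₂ u) (inj₂ v) = ∨-identityʳ _

-- Vertex sets may be empty, which gives `Buildable-homogeneous` its starting point.
Buildable : ∀ {V} → ℕ → Adjacency V → Set
Buildable k R = ∃[ n ] Σ (Construction k n) λ e → edge e ≃ R

Buildable-resp-≃ : ∀ {k A B} {R : Adjacency A} {S : Adjacency B} →
  R ≃ S → Buildable k R → Buildable k S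
Buildable-resp-≃ f (n , e , g) = n , e , ≃-trans g f

Buildable-leaf : ∀ {k} → Buildable (suc k) (adjᵗ leaf)
Buildable-leaf = 1 , addVertex zero start ,
  mk≃ (↔-sym (bij leaf-≃)) λ { zero zero → refl }

mergeAll-≃ : ∀ {k n} (e : Construction (suc k) n) → edge e ≃ edge (mergeAll e)
mergeAll-≃ e = mk≃ ↔-refl λ u v → sym (mergeInto₀-edge (allFin _) e u v)

module _ {k m n : ℕ} (e : Construction (suc k) m) (f : Construction (2 + k) n)
  (e₀ : ∀ u → label e u ≡ zero) (f₀ : ∀ v → label f v ≡ zero) where

  glueConstruction : Bool → Construction (2 + k) (m + n)
  glueConstruction false = append e f
  -- After `append`, label 1 marks exactly the vertices of `e` and label 0 those of `f`.
  glueConstruction true  = connect zero (suc zero) (λ ()) (append e f)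

  glueConstruction-edge : ∀ b x y →
    edge (glueConstruction b) (joinᶠ m n x) (joinᶠ m n y) ≡ glue b (edge e) (edge f) x y
  glueConstruction-edge false x y = append-edge f f₀ e x y
  glueConstruction-edge true  x y
    rewrite append-edge f f₀ e x y | append-label f f₀ e x | append-label f f₀ e y = new x y
    where
    old = glue false (edge e) (edge f)
    lab = label⊎ f f₀ e
    new : ∀ x y →
      old x y ∨ ((⌊ lab x ≟ zero ⌋ ∧ ⌊ lab y ≟ suc zero ⌋)
              ∨  (⌊ lab x ≟ suc zero ⌋ ∧ ⌊ lab y ≟ zero ⌋))
      ≡ glue true (edge e) (edge f) x y
    new (inj₁ u) (inj₁ v) rewrite e₀ u        = ∨-identityʳ _
    new (inj₁ u) (inj₂ v) rewrite e₀ u        = refl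
    new (inj₂ u) (inj₁ v) rewrite e₀ v        = refl
    new (inj₂ u) (inj₂ v)                     = ∨-identityʳ _

  glueConstruction-≃ : ∀ b → glue b (edge e) (edge f) ≃ edge (glueConstruction b)
  glueConstruction-≃ b = mk≃ (↔-sym +↔⊎) λ x y → sym (glueConstruction-edge b x y)

-- Label 0 is reserved for the part already built, so only the attached part S needs k fresh labels.
attach : ∀ {k b A B} {R : Adjacency A} {S : Adjacency B} → B →
  Buildable (suc k) R → Buildable k S → Buildable (suc k) (glue b R S)
-- The vertex `s` would need a label from the empty alphabet.
attach {zero} s _ (_ , e , g) with label e (from (bij g) s)
... | ()
attach {suc k} {b} s (_ , f , h) (_ , e , g) =
  _ , glueConstruction (mergeAll e) (mergeAll f) (mergeAll-label e) (mergeAll-label f) b ,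
  ≃-trans (≃-sym (glueConstruction-≃ (mergeAll e) (mergeAll f) (mergeAll-label e) (mergeAll-label f) b))
    (≃-trans (glue-cong (≃-trans (≃-sym (mergeAll-≃ e)) g) (≃-trans (≃-sym (mergeAll-≃ f)) h))
      glue-comm)

data Homogeneous (b : Bool) (P : Cotree → Set) : Cotree → Set where
  atom : ∀ {t} → P t → Homogeneous b P t
  node : ∀ {l r} → Homogeneous b P l → Homogeneous b P r → Homogeneous b P (node b l r)

BuildableTree : ℕ → Cotree → Set
BuildableTree k t = Buildable k (adjᵗ t)

-- By associativity the bracketing is immaterial, so the atoms are attached to `R` one at a time;
-- all these steps share the one extra label.
attach-homogeneous : ∀ {k b A t} {R : Adjacency A} → Homogeneous b (BuildableTree k) t →
  Buildable (suc k) R → Buildable (suc k) (glue b R (adjᵗ t))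
attach-homogeneous {t = t} (atom w) v = attach (some-leaf t) v w
attach-homogeneous (node p q)       v =
  Buildable-resp-≃ glue-assoc (attach-homogeneous q (attach-homogeneous p v))

glue-empty : ∀ {b B} {R : Adjacency (Fin 0)} {S : Adjacency B} → glue b R S ≃ S
glue-empty {b} {R = R} {S} =
  mk≃ (mk↔ₛ′ [ (λ ()) , id ]′ inj₂ (λ _ → refl) λ { (inj₁ ()) ; (inj₂ _) → refl }) p
  where
  p : ∀ x y → glue b R S x y ≡ S ([ (λ ()) , id ]′ x) ([ (λ ()) , id ]′ y)
  p (inj₂ _) (inj₂ _) = refl

Buildable-homogeneous : ∀ {k b t} → Homogeneous b (BuildableTree k) t → BuildableTree (suc k) t
Buildable-homogeneous p =
  Buildable-resp-≃ glue-empty (attach-homogeneous {b = _} p (0 , start , ≃-refl))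

Buildable⇒ConstructibleWith : ∀ {k G} → Buildable k (adj G) → ConstructibleWith k G
Buildable⇒ConstructibleWith (zero  , _ , g) with from (bij g) zero
... | ()
Buildable⇒ConstructibleWith (suc m , e , g) = m , e , ≃⇒≅ g

-- Cotrees avoiding a quasi-threshold graph and a complement of one

-- Q true n t says that the cotree t displays T n, and QQ true n t that it displays T n ∪ T n; for false, the complements of these.

mutual
  Q : Bool → ℕ → Cotree → Set
  Q b zero    _            = ⊤
  Q b (suc n) leaf         = ⊥
  Q b (suc n) (node c l r) =
    (c ≡ b × (QQ b n l ⊎ QQ b n r)) ⊎ Q b (suc n) l ⊎ Q b (suc n) r

  QQ : Bool → ℕ → Cotree → Set
  QQ b n leaf         = ⊥
  QQ b n (node c l r) = (c ≡ not b × Q b n l × Q b n r) ⊎ QQ b n l ⊎ QQ b n r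

-- Decidability lets `caterpillar` choose constructively the branch to attach.
mutual
  Q? : ∀ b n t → Dec (Q b n t)
  Q? b zero    _            = yes tt
  Q? b (suc n) leaf         = no λ ()
  Q? b (suc n) (node c l r) =
    (c ≟ᵇ b ×-dec (QQ? b n l ⊎-dec QQ? b n r)) ⊎-dec Q? b (suc n) l ⊎-dec Q? b (suc n) r

  QQ? : ∀ b n t → Dec (QQ b n t)
  QQ? b n leaf         = no λ ()
  QQ? b n (node c l r) =
    (c ≟ᵇ not b ×-dec Q? b n l ×-dec Q? b n r) ⊎-dec QQ? b n l ⊎-dec QQ? b n r

Q-suc⇒QQ : ∀ b n t → Q b (suc n) t → QQ b n t
Q-suc⇒QQ b n (node c l r) (inj₁ (_ , p)) = inj₂ p
Q-suc⇒QQ b n (node c l r) (inj₂ p)       = inj₂ (⊎-map (Q-suc⇒QQ b n l) (Q-suc⇒QQ b n r) p)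

QQ⇒Q : ∀ b n t → QQ b n t → Q b n t
QQ⇒Q b zero    _            _                    = tt
QQ⇒Q b (suc n) (node c l r) (inj₁ (_ , p , _))   = inj₂ (inj₁ p)
QQ⇒Q b (suc n) (node c l r) (inj₂ p)             = inj₂ (⊎-map (QQ⇒Q b (suc n) l) (QQ⇒Q b (suc n) r) p)

∀-Bool : ∀ {P : Bool → Set} b → P b → P (not b) → ∀ c → P c
∀-Bool false p q = λ { false → p ; true → q }
∀-Bool true  p q = λ { true → p ; false → q }

-- `side` is the induction hypothesis of `avoiding-buildable`: the index of one sign has dropped by
-- one.
module _ (n : Bool → ℕ) (k : ℕ)
  (side : ∀ b t → ¬ Q b (n b) t → ¬ Q (not b) (suc (n (not b))) t → BuildableTree k t) where

  -- One branch of every node satisfies `side`, so the other branches form a path to be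
  -- built from the bottom up.
  caterpillar : ∀ t → (∀ b → ¬ QQ b (n b) t) → BuildableTree (suc k) t
  caterpillar leaf         avoid = Buildable-leaf
  caterpillar (node c l r) avoid with Q? (not c) (n (not c)) r
  ... | no ¬r =
    attach (some-leaf r)
      (caterpillar l λ b → avoid b ∘ inj₂ ∘ inj₁)
      (side (not c) r ¬r (avoid _ ∘ inj₂ ∘ inj₂ ∘ Q-suc⇒QQ _ _ r))
  ... | yes pr =
    Buildable-resp-≃ glue-comm
      (attach (some-leaf l)
        (caterpillar r λ b → avoid b ∘ inj₂ ∘ inj₂)
        (side (not c) l (λ pl → avoid (not c) (inj₁ (sym (not-involutive c) , pl , pr)))
          (avoid _ ∘ inj₂ ∘ inj₁ ∘ Q-suc⇒QQ _ _ l)))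

  -- Descend through the nodes labelled `b`. At the first other node, `QQ` of sign `not b` would lie
  -- inside one branch, and a leaf of the other branch would complete it to the excluded `Q`; hence
  -- `caterpillar` applies.
  homogeneous : ∀ b t → ¬ Q (not b) (suc (n (not b))) t → ¬ QQ b (n b) t →
    Homogeneous b (BuildableTree (suc k)) t
  homogeneous b leaf         _  _   = atom Buildable-leaf
  homogeneous b (node c l r) ¬q ¬qq with c ≟ᵇ b
  ... | yes refl =
    node (homogeneous b l (¬q ∘ inj₂ ∘ inj₁) (¬qq ∘ inj₂ ∘ inj₁))
         (homogeneous b r (¬q ∘ inj₂ ∘ inj₂) (¬qq ∘ inj₂ ∘ inj₂))
  ... | no c≢b = atom (caterpillar (node c l r) (∀-Bool b ¬qq λ where
    (inj₁ (c≡ , _)) → c≢b (trans c≡ (not-involutive b))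
    (inj₂ p)        → ¬q (inj₁ (¬-not c≢b , p))))

  -- Under a root labelled `c`, `QQ` of sign `c` in one branch would be completed to `Q` by a leaf
  -- of the other, so both branches are homogeneous. One new label serves the paths, the other their
  -- assembly.
  bounded : ∀ t → (∀ b → ¬ Q b (suc (n b)) t) → BuildableTree (2 + k) t
  bounded leaf         avoid = Buildable-leaf
  bounded (node c l r) avoid = Buildable-homogeneous (node
    (homogeneous c l (avoid (not c) ∘ inj₂ ∘ inj₁) (λ q → avoid c (inj₁ (refl , inj₁ q))))
    (homogeneous c r (avoid (not c) ∘ inj₂ ∘ inj₂) (λ q → avoid c (inj₁ (refl , inj₂ q)))))

select : ∀ {A : Set} → A → A → Bool → A
select x y true  = x
select x y false = y

width : ℕ → ℕ
width zero    = 0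
width (suc s) = 2 + width s

-- Every cotree displays T 0 and its complement, so the cases m = 0 and n = 0 are vacuous.
avoiding-buildable : ∀ s m n → m + n ≡ s → ∀ t →
  ¬ Q true m t → ¬ Q false n t → BuildableTree (width s) t
avoiding-buildable s       zero    n       _ t ¬p _  = contradiction tt ¬p
avoiding-buildable s       (suc m) zero    _ t _  ¬q = contradiction tt ¬q
avoiding-buildable (suc s) (suc m) (suc n) e t ¬p ¬q =
  bounded (select m n) (width s) side t λ { true → ¬p ; false → ¬q }
  where
  m+1+n≡s : m + suc n ≡ s
  m+1+n≡s = suc-injective e
  side : ∀ b t → ¬ Q b (select m n b) t → ¬ Q (not b) (suc (select m n (not b))) t →
    BuildableTree (width s) t
  side true  t ¬p ¬q = avoiding-buildable s m (suc n) m+1+n≡s t ¬p ¬q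
  side false t ¬p ¬q = avoiding-buildable s (suc m) n (trans (sym (+-suc m n)) m+1+n≡s) t ¬q ¬p

-- Displayed graphs embed

sign : Bool → Bool → Bool
sign true  x = x
sign false x = not x

-- For `b = false` this embeds the complement. The diagonal is exempt because `sign false` would
-- make it `true`.
record Embeds {V} (b : Bool) (R : Adjacency V) (t : Cotree) : Set where
  field
    ⟦_⟧       : V → Leaf t
    injective : ∀ {x y} → ⟦_⟧ x ≡ ⟦_⟧ y → x ≡ y
    preserves : ∀ {x y} → x ≢ y → adjᵗ t (⟦_⟧ x) (⟦_⟧ y) ≡ sign b (R x y)

open Embeds

Embeds-resp-≃ : ∀ {A B b t} {R : Adjacency A} {S : Adjacency B} →
  R ≃ S → Embeds b R t → Embeds b S t
Embeds-resp-≃ {b = b} {S = S} f m = record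
  { ⟦_⟧       = ⟦ m ⟧ ∘ from (bij f)
  ; injective = from-injective ∘ injective m
  ; preserves = λ x≢y → trans (preserves m (x≢y ∘ from-injective))
      (cong (sign b) (sym (pres (≃-sym f) _ _)))
  }
  where
  from-injective : ∀ {x y} → from (bij f) x ≡ from (bij f) y → x ≡ y
  from-injective = Injection.injective (↔⇒↣ (↔-sym (bij f)))

module _ {V : Set} {b c : Bool} {l r : Cotree} {R : Adjacency V} where

  Embedsˡ : Embeds b R l → Embeds b R (node c l r)
  Embedsˡ m = record
    { ⟦_⟧       = inj₁ ∘ ⟦ m ⟧
    ; injective = injective m ∘ inj₁-injective
    ; preserves = preserves m
    }

  Embedsʳ : Embeds b R r → Embeds b R (node c l r)
  Embedsʳ m = record
    { ⟦_⟧       = inj₂ ∘ ⟦ m ⟧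
    ; injective = injective m ∘ inj₂-injective
    ; preserves = preserves m
    }

Embeds-K₁ : ∀ b t → Embeds b (adj K₁) t
Embeds-K₁ b t = record
  { ⟦_⟧       = λ _ → some-leaf t
  ; injective = λ { {zero} {zero} _ → refl }
  ; preserves = λ { {zero} {zero} x≢y → contradiction refl x≢y }
  }

-- Complementation exchanges union and join, hence the label `sign b d`.
Embeds-Glue : ∀ {b d l r G H} → Embeds b (adj G) l → Embeds b (adj H) r →
  Embeds b (adj (Glue.graph d G H)) (node (sign b d) l r)
Embeds-Glue {b} {d} {l} {r} {G} {H} m n = Embeds-resp-≃ (Glue-≃ d G H) record
  { ⟦_⟧       = ⊎-map ⟦ m ⟧ ⟦ n ⟧
  ; injective = inj _ _
  ; preserves = pre _ _
  }
  where
  inj : ∀ x y → ⊎-map ⟦ m ⟧ ⟦ n ⟧ x ≡ ⊎-map ⟦ m ⟧ ⟦ n ⟧ y → x ≡ y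
  inj (inj₁ _) (inj₁ _) p = cong inj₁ (injective m (inj₁-injective p))
  inj (inj₂ _) (inj₂ _) p = cong inj₂ (injective n (inj₂-injective p))
  pre : ∀ x y → x ≢ y →
    adjᵗ (node (sign b d) l r) (⊎-map ⟦ m ⟧ ⟦ n ⟧ x) (⊎-map ⟦ m ⟧ ⟦ n ⟧ y)
      ≡ sign b (glue d (adj G) (adj H) x y)
  pre (inj₁ _) (inj₁ _) x≢y = preserves m (x≢y ∘ cong inj₁)
  pre (inj₁ _) (inj₂ _) _   = refl
  pre (inj₂ _) (inj₁ _) _   = refl
  pre (inj₂ _) (inj₂ _) x≢y = preserves n (x≢y ∘ cong inj₂)

sign-true : ∀ b → sign b true ≡ b
sign-true true  = refl
sign-true false = refl

sign-false : ∀ b → sign b false ≡ not b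
sign-false true  = refl
sign-false false = refl

module _ {G : Graph} (b : Bool) (n : ℕ) where

  QQ⇒Embeds-∪ : ∀ {H} →
    (∀ t → Q b n t → Embeds b (adj G) t) → (∀ t → Q b n t → Embeds b (adj H) t) →
    ∀ t → QQ b n t → Embeds b (adj (G ∪ H)) t
  QQ⇒Embeds-∪ {H} g h (node c l r) (inj₁ (refl , p , q)) =
    subst (λ c → Embeds b (adj (G ∪ H)) (node c l r)) (sign-false b)
      (Embeds-Glue (g l p) (h r q))
  QQ⇒Embeds-∪ g h (node c l r) (inj₂ (inj₁ p)) = Embedsˡ (QQ⇒Embeds-∪ g h l p)
  QQ⇒Embeds-∪ g h (node c l r) (inj₂ (inj₂ p)) = Embedsʳ (QQ⇒Embeds-∪ g h r p)

  -- Any leaf of the branch opposite to the copy of `G` serves as `K₁`; if that copy is on the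
  -- right, the factors are swapped.
  Q⇒Embeds-∗K₁ : (∀ t → QQ b n t → Embeds b (adj G) t) →
    ∀ t → Q b (suc n) t → Embeds b (adj (G ∗ K₁)) t
  Q⇒Embeds-∗K₁ g (node c l r) (inj₁ (refl , inj₁ p)) =
    subst (λ c → Embeds b (adj (G ∗ K₁)) (node c l r)) (sign-true b)
      (Embeds-Glue (g l p) (Embeds-K₁ b r))
  Q⇒Embeds-∗K₁ g (node c l r) (inj₁ (refl , inj₂ p)) =
    subst (λ c → Embeds b (adj (G ∗ K₁)) (node c l r)) (sign-true b)
      (Embeds-resp-≃ K₁∗G≃G∗K₁ (Embeds-Glue (Embeds-K₁ b l) (g r p)))
    where
    K₁∗G≃G∗K₁ : adj (K₁ ∗ G) ≃ adj (G ∗ K₁)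
    K₁∗G≃G∗K₁ = ≃-trans (≃-sym (Glue-≃ true K₁ G)) (≃-trans glue-comm (Glue-≃ true G K₁))
  Q⇒Embeds-∗K₁ g (node c l r) (inj₂ (inj₁ p)) = Embedsˡ (Q⇒Embeds-∗K₁ g l p)
  Q⇒Embeds-∗K₁ g (node c l r) (inj₂ (inj₂ p)) = Embedsʳ (Q⇒Embeds-∗K₁ g r p)

rank : ∀ {G} → QuasiThreshold G → ℕ
rank single      = 0
rank (union g h) = suc (rank g ⊔ rank h)
rank (join g)    = suc (rank g)
rank (iso _ g)   = rank g

-- The parts of a union go into the two copies of `T n` inside `T (suc n)`; for a join, one copy and
-- the dominating vertex suffice.
Q⇒Embeds : ∀ {G} (g : QuasiThreshold G) b {n} → rank g ≤ n → ∀ t → Q b n t → Embeds b (adj G) t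
Q⇒Embeds single      b _         t _ = Embeds-K₁ b t
Q⇒Embeds (union g h) b (s≤s g⊔h≤n) t p =
  QQ⇒Embeds-∪ b _ (Q⇒Embeds g b (≤-trans (m≤m⊔n _ _) g⊔h≤n))
    (Q⇒Embeds h b (≤-trans (m≤n⊔m (rank g) _) g⊔h≤n)) t (Q-suc⇒QQ b _ t p)
Q⇒Embeds (join g)    b (s≤s g≤n) t p =
  Q⇒Embeds-∗K₁ b _ (λ t → Q⇒Embeds g b g≤n t ∘ QQ⇒Q b _ t) t p
Q⇒Embeds (iso i g)   b g≤n       t p = Embeds-resp-≃ (≅⇒≃ i) (Q⇒Embeds g b g≤n t p)

Embeds-true⇒⊑ : ∀ {G H t} → adjᵗ t ≃ adj G → Embeds true (adj H) t → H ⊑ G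
Embeds-true⇒⊑ {G} {H} {t} f m = record
  { injection = mk↣ (injective m ∘ Injection.injective (↔⇒↣ (bij f)))
  ; preserves = λ u v → trans (adj-pres u v) (pres f _ _)
  }
  where
  adj-pres : ∀ u v → adj H u v ≡ adjᵗ t (⟦ m ⟧ u) (⟦ m ⟧ v)
  adj-pres u v with u ≟ v
  ... | yes refl = trans (adj-irrefl H u) (sym (adjᵗ-irrefl t _))
  ... | no u≢v   = sym (preserves m u≢v)

complement-≢ : ∀ G {u v} → u ≢ v → adj (complement G) u v ≡ not (adj G u v)
complement-≢ G {u} {v} u≢v with u ≟ v
... | yes u≡v = contradiction u≡v u≢v
... | no _    = refl

Embeds-complement : ∀ {H t} → Embeds false (adj H) t → Embeds true (adj (complement H)) t
Embeds-complement {H} m = record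
  { ⟦_⟧       = ⟦ m ⟧
  ; injective = injective m
  ; preserves = λ u≢v → trans (preserves m u≢v) (sym (complement-≢ H u≢v))
  }

-- The upper bound for hereditary classes

module _ {ℓ : Level} {C : Pred Graph ℓ} (hereditary : Hereditary C) (C⊆Cograph : C ⊆ Cograph) where
  open Hereditary hereditary

  avoiding⇒bounded : ∀ {G H} →
    QuasiThreshold G → ¬ C G → QuasiThreshold H → ¬ C (complement H) → BoundedLcw C
  avoiding⇒bounded {H = H} g G∉C h H∉C = width s , λ K K∈C →
    let t , f = cotree (C⊆Cograph K∈C) in
    width s , ≤-refl , Buildable⇒ConstructibleWith (Buildable-resp-≃ f
      (avoiding-buildable s (rank g) (rank h) refl t
        (λ q → G∉C (⊑-closed (Embeds-true⇒⊑ f (Q⇒Embeds g true ≤-refl t q)) K∈C))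
        (λ q → H∉C (⊑-closed (Embeds-true⇒⊑ f (Embeds-complement {H}
          (Q⇒Embeds h false ≤-refl t q))) K∈C))))
    where s = rank g + rank h

-- Rows of an adjacency matrix across a cut

-- The vertices at position ≥ cut come first, since constructions number the newest vertex 0.
record Rows {V : Set} (R : Adjacency V) (pos : V → ℕ) (g : ℕ) : Set where
  field
    cut      : ℕ
    row      : Fin g → V
    early    : ∀ i → cut ≤ pos (row i)
    -- This drives the induction: a new row that vanishes on the late vertices of a copy differs
    -- from every row of that copy.
    nonzero  : ∀ i → ∃[ w ] pos w < cut × R (row i) w ≡ true
    distinct : ∀ {i j} → i <ᶠ j → ∃[ w ] pos w < cut × R (row i) w ≢ R (row j) w

open Rows

addRow : ∀ {V W g R S} {pos : W → ℕ} (φ : V → W) → (∀ x y → S (φ x) (φ y) ≡ R x y) →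
  (ρ : Rows R (pos ∘ φ) g) → ∀ u → cut ρ ≤ pos u →
  (∃[ w ] pos w < cut ρ × S u w ≡ true) →
  (∀ i → ∃[ w ] pos w < cut ρ × S u w ≢ S (φ (row ρ i)) w) →
  Rows S pos (suc g)
addRow {S = S} {pos} φ φ-pres ρ u u-early u-nonzero u-distinct = record
  { cut      = cut ρ
  ; row      = row′
  ; early    = λ { zero → u-early ; (suc i) → early ρ i }
  ; nonzero  = λ where
      zero    → u-nonzero
      (suc i) → let w , w< , p = nonzero ρ i in φ w , w< , trans (φ-pres _ _) p
  ; distinct = distinct′ _ _
  }
  where
  row′ : Fin (suc _) → _
  row′ zero    = u
  row′ (suc i) = φ (row ρ i)
  distinct′ : ∀ i j → i <ᶠ j → ∃[ w ] pos w < cut ρ × S (row′ i) w ≢ S (row′ j) w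
  distinct′ zero    (suc j) _         = u-distinct j
  distinct′ (suc i) (suc j) (s<s i<j) = let w , w< , p = distinct ρ i<j in
    φ w , w< , λ q → p (trans (sym (φ-pres _ _)) (trans q (φ-pres _ _)))

true≢false : ∀ {x y} → x ≡ true → y ≡ false → x ≢ y
true≢false refl refl ()

-- If the apex v is early, then its row is the only one that sees the late vertices of C.
-- If it is late, then a row of A is the only one that sees v but no late vertex of B.
median-Rows : ∀ {V W g R S} {pos : W → ℕ} (A B C : V → W) (v : W) →
  (∀ x y → S (B x) (B y) ≡ R x y) →
  (∀ x y → S (A x) (B y) ≡ false) → (∀ x y → S (B x) (C y) ≡ false) →
  (∀ x → S (A x) v ≡ true) → (∀ x → S v (C x) ≡ true) →
  (α : Rows R (pos ∘ A) (suc g)) (β : Rows R (pos ∘ B) (suc g)) (γ : Rows R (pos ∘ C) (suc g)) →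
  cut γ ≤ cut β → cut β ≤ cut α → Rows S pos (2 + g)
median-Rows {S = S} {pos} A B C v B-pres AB BC Av vC α β γ γ≤β β≤α
  with ≤-<-connex (cut β) (pos v)
... | inj₁ v-early =
  -- A vertex late for `γ` is late for the median cut as well.
  let w , w<γ , _ = nonzero γ zero
      w<β = <-≤-trans w<γ γ≤β
  in addRow B B-pres β v v-early (C w , w<β , vC w)
       λ i → C w , w<β , true≢false (vC w) (BC _ _)
... | inj₂ v-late =
  addRow B B-pres β (A a) (≤-trans β≤α (early α zero)) (v , v-late , Av a)
    λ i → let w , w<β , p = nonzero β i in
      B w , w<β , λ q → true≢false (trans (B-pres _ _) p) (AB _ _) (sym q)
  where a = row α zero

-- Three copies, where `T` has two, provide a median cut. The base is an edge because a nonzero row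
-- needs a neighbour.
U : ℕ → Cotree
U zero    = node true leaf leaf
U (suc n) = node true (node false (node false (U n) (U n)) (U n)) leaf

U-Rows : ∀ n (pos : Leaf (U n) → ℕ) → (∀ {x y} → pos x ≡ pos y → x ≡ y) →
  Rows (adjᵗ (U n)) pos (suc n)
-- The cut separates the ends of the edge; the end added first is the row.
U-Rows zero pos inj with <-cmp (pos (inj₁ tt)) (pos (inj₂ tt))
... | tri< p _ _ = record
  { cut = _ ; row = λ _ → inj₂ tt ; early = λ _ → ≤-refl
  ; nonzero = λ _ → inj₁ tt , p , refl ; distinct = λ { {zero} {zero} () } }
... | tri> _ _ p = record
  { cut = _ ; row = λ _ → inj₁ tt ; early = λ _ → ≤-refl
  ; nonzero = λ _ → inj₂ tt , p , refl ; distinct = λ { {zero} {zero} () } }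
... | tri≈ _ p _ with inj p
... | ()
U-Rows (suc n) pos inj =
  sorted (≤-total (cut α) (cut β)) (≤-total (cut β) (cut γ)) (≤-total (cut α) (cut γ))
  where
  v = inj₂ tt
  A B C : Leaf (U n) → Leaf (U (suc n))
  A = inj₁ ∘ inj₁ ∘ inj₁
  B = inj₁ ∘ inj₁ ∘ inj₂
  C = inj₁ ∘ inj₂
  α : Rows (adjᵗ (U n)) (pos ∘ A) (suc n)
  α = U-Rows n (pos ∘ A) (inj₁-injective ∘ inj₁-injective ∘ inj₁-injective ∘ inj)
  β : Rows (adjᵗ (U n)) (pos ∘ B) (suc n)
  β = U-Rows n (pos ∘ B) (inj₂-injective ∘ inj₁-injective ∘ inj₁-injective ∘ inj)
  γ : Rows (adjᵗ (U n)) (pos ∘ C) (suc n)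
  γ = U-Rows n (pos ∘ C) (inj₂-injective ∘ inj₁-injective ∘ inj)
  sorted : cut α ≤ cut β ⊎ cut β ≤ cut α → cut β ≤ cut γ ⊎ cut γ ≤ cut β →
    cut α ≤ cut γ ⊎ cut γ ≤ cut α → Rows (adjᵗ (U (suc n))) pos (2 + n)
  -- The copies are pairwise nonadjacent and all joined to `v`, so the adjacency conditions compute
  -- in every order.
  sorted (inj₁ α≤β) (inj₁ β≤γ) _ =
    median-Rows C B A v (λ _ _ → refl) (λ _ _ → refl) (λ _ _ → refl)
      (λ _ → refl) (λ _ → refl) γ β α α≤β β≤γ
  sorted (inj₁ α≤β) (inj₂ γ≤β) (inj₁ α≤γ) =
    median-Rows B C A v (λ _ _ → refl) (λ _ _ → refl) (λ _ _ → refl)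
      (λ _ → refl) (λ _ → refl) β γ α α≤γ γ≤β
  sorted (inj₁ α≤β) (inj₂ γ≤β) (inj₂ γ≤α) =
    median-Rows B A C v (λ _ _ → refl) (λ _ _ → refl) (λ _ _ → refl)
      (λ _ → refl) (λ _ → refl) β α γ γ≤α α≤β
  sorted (inj₂ β≤α) (inj₁ β≤γ) (inj₁ α≤γ) =
    median-Rows C A B v (λ _ _ → refl) (λ _ _ → refl) (λ _ _ → refl)
      (λ _ → refl) (λ _ → refl) γ α β β≤α α≤γ
  sorted (inj₂ β≤α) (inj₁ β≤γ) (inj₂ γ≤α) =
    median-Rows A C B v (λ _ _ → refl) (λ _ _ → refl) (λ _ _ → refl)
      (λ _ → refl) (λ _ → refl) α γ β β≤γ γ≤α
  sorted (inj₂ β≤α) (inj₂ γ≤β) _ =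
    median-Rows A B C v (λ _ _ → refl) (λ _ _ → refl) (λ _ _ → refl)
      (λ _ → refl) (λ _ → refl) α β γ γ≤β β≤α

-- Labels bound the number of distinct rows

-- Vertices p, p + 1, … are those present just before vertex p − 1 is added, and f gives their
-- labels at that moment.
labels-at-cut : ∀ {k n} (e : Construction k n) p → Σ (Fin n → Fin k) λ f → ∀ u v →
  p ≤ toℕ u → p ≤ toℕ v → f u ≡ f v →
  label e u ≡ label e v × (∀ w → toℕ w < p → edge e u w ≡ edge e v w)
labels-at-cut start             p       = (λ ()) , λ ()
labels-at-cut (addVertex i e)   zero    = label (addVertex i e) , λ _ _ _ _ q → q , λ _ ()
labels-at-cut {k} {suc n} (addVertex i e) (suc p) = f , same
  where
  f′ = proj₁ (labels-at-cut e p)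
  f : Fin (suc n) → Fin k
  -- A default value: `zero` lies after the cut.
  f zero    = i
  f (suc u) = f′ u
  same : ∀ u v → suc p ≤ toℕ u → suc p ≤ toℕ v → f u ≡ f v →
    label (addVertex i e) u ≡ label (addVertex i e) v
      × (∀ w → toℕ w < suc p → edge (addVertex i e) u w ≡ edge (addVertex i e) v w)
  same (suc u) (suc v) (s≤s p≤u) (s≤s p≤v) q =
    let l , s = proj₂ (labels-at-cut e p) u v p≤u p≤v q in
    l , λ { zero _ → refl ; (suc w) (s≤s w<p) → s w w<p }
-- The labels of `u` and `v` still agree here, so `connect` treats both alike.
labels-at-cut (connect i j i≢j e) p = let f , same = labels-at-cut e p in
  f , λ u v p≤u p≤v q → let l , s = same u v p≤u p≤v q in l , λ w w<p → cong₂
    (λ x a → x ∨ ((⌊ a ≟ i ⌋ ∧ ⌊ label e w ≟ j ⌋) ∨ (⌊ a ≟ j ⌋ ∧ ⌊ label e w ≟ i ⌋)))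
    (s w w<p) l
labels-at-cut (relabel i j e)   p = let f , same = labels-at-cut e p in
  f , λ u v p≤u p≤v q → map (cong (rename i j)) id (same u v p≤u p≤v q)

-- By pigeonhole two early vertices share a label at the cut, hence their rows agree. Asking only
-- that off-diagonal equalities in `G` carry over to `R` covers both a graph and its complement.
¬ConstructibleWith : ∀ {V R k g} G (φ : V ↔ Vertex G) →
  (∀ {x y z} → x ≢ z → y ≢ z →
    adj G (to φ x) (to φ z) ≡ adj G (to φ y) (to φ z) → R x z ≡ R y z) →
  (∀ (pos : V → ℕ) → (∀ {x y} → pos x ≡ pos y → x ≡ y) → Rows R pos g) →
  k < g → ¬ ConstructibleWith k G
¬ConstructibleWith {V} {R} {k} {g} G φ reflects rows k<g (m , e , i) =
  let f , same = labels-at-cut e (cut ρ)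
      a , b , a<b , fa≡fb = pigeonhole k<g (λ x → f (at (row ρ x)))
      w , w<cut , Ra≢Rb = distinct ρ a<b
      u = row ρ a
      v = row ρ b
      -- Rows are early and `w` is late, which keeps the comparison off the diagonal.
      ≢w : ∀ x → row ρ x ≢ w
      ≢w x x≡w = <⇒≱ w<cut (subst (λ y → cut ρ ≤ pos y) x≡w (early ρ x))
      eq = proj₂ (same (at u) (at v) (early ρ a) (early ρ b) fa≡fb) (at w) w<cut
  in Ra≢Rb (reflects (≢w a) (≢w b) (trans (adj-at u w) (trans eq (sym (adj-at v w)))))
  where
  ψ : V ↔ Fin (suc m)
  ψ = ↔-trans φ (↔-sym (_≅_.bijection i))
  at : V → Fin (suc m)
  at = to ψ
  pos : V → ℕ
  pos = toℕ ∘ at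
  ρ = rows pos (Injection.injective (↔⇒↣ ψ) ∘ toℕ-injective)
  adj-at : ∀ x y → adj G (to φ x) (to φ y) ≡ edge e (at x) (at y)
  adj-at x y = pres (≃-sym (≅⇒≃ i)) _ _

U-graph : ∀ n → ∃[ G ] QuasiThreshold G × (adjᵗ (U n) ≃ adj G)
U-graph zero    = K₁ ∗ K₁ , join single , node-≃ leaf-≃ leaf-≃
U-graph (suc n) = let G , q , f = U-graph n in
  ((G ∪ G) ∪ G) ∗ K₁ , join (union (union q q) q) ,
  node-≃ {G = (G ∪ G) ∪ G} (node-≃ {G = G ∪ G} (node-≃ f f) f) leaf-≃

-- Every insertion order of `U c` has a cut with `suc c` distinct rows, and negating off-diagonal
-- entries keeps them distinct, so one graph serves both claims.
unbounded-U : ∀ c → ∃[ G ] QuasiThreshold G × ¬ (lcw[ G ]≤ c) × ¬ (lcw[ complement G ]≤ c)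
unbounded-U c = let G , q , f = U-graph c in
  G , q ,
  (λ (k , k≤c , con) → ¬ConstructibleWith G (bij f)
    (λ _ _ p → trans (pres f _ _) (trans p (sym (pres f _ _)))) (U-Rows c) (s≤s k≤c) con) ,
  (λ (k , k≤c , con) → ¬ConstructibleWith (complement G) (bij f)
    (λ x≢z y≢z p → trans (pres f _ _) (trans (not-injective
      (trans (sym (complement-≢ G (x≢z ∘ inj f))) (trans p (complement-≢ G (y≢z ∘ inj f)))))
      (sym (pres f _ _)))) (U-Rows c) (s≤s k≤c) con)
  where
  inj : ∀ {A B} {R : Adjacency A} {S : Adjacency B} (f : R ≃ S) {x y} →
    to (bij f) x ≡ to (bij f) y → x ≡ y
  inj f = Injection.injective (↔⇒↣ (bij f))

theorem1p1 : ∀ {ℓ : Level} (C : Pred Graph ℓ) → Hereditary C → C ⊆ Cograph →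
    BoundedLcw C ⇔
    ((∃[ G ] QuasiThreshold G × ¬ C G) × (∃[ G ] QuasiThreshold G × ¬ C (complement G)))
theorem1p1 C hereditary C⊆Cograph = mk⇔
  (λ (c , bound) → let G , q , G-wide , coG-wide = unbounded-U c in
    (G , q , G-wide ∘ bound G) , (G , q , coG-wide ∘ bound (complement G)))
  (λ ((G , g , G∉C) , (H , h , H∉C)) → avoiding⇒bounded hereditary C⊆Cograph g G∉C h H∉C)
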